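{- Let $G$ be a connected graph, let $u,v\in V(G)$, and let $u=w_0,w_1,\dots,w_k=v$ with $k\geq 2$ be an internal path between $u$ and $v$, i.e. $w_iw_{i+1}\in E(G)$ for $0\le i\le k-1$ and each of $w_1,\dots,w_{k-1}$ has degree two in $G$. Let $H=G-w_1-\dots-w_{k-1}$ be the graph obtained by deleting $w_1,\dots,w_{k-1}$ from $G$. Then the sequence $Tr_G(w_0),Tr_G(w_1),\dots,Tr_G(w_k)$ is unimodal if $H$ is connected, and inversely unimodal if $H$ is disconnected.
   Context: $Tr_G(x)=\sum_{y\in V(G)} d_G(x,y)$ is the transmission of $x$, where $d_G$ is the shortest-path distance. A sequence $s_1,\dots,s_m$ is unimodal if there is $t\in\{1,\dots,m\}$ with $s_1\le\dots\le s_t\ge s_{t+1}\ge\dots\ge s_m$, and inversely unimodal if there is $t$ with $s_1\ge\dots\ge s_t\le s_{t+1}\le\dots\le s_m$. -}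

module Defs where

open import Data.Fin as Fin using (Fin; zero; suc; inject₁; fromℕ; toℕ)
open import Data.Fin.Properties as Fin using (any?)
open import Data.List using (length; filter; allFin)
open import Data.Nat using (ℕ; zero; suc; _≤_; _≥_; _<_; z≤n; s≤s)
open import Data.Nat.Properties using (+-0-commutativeMonoid)
open import Algebra.Properties.CommutativeMonoid.Sum +-0-commutativeMonoid using (sum-syntax)
open import Data.Product using (Σ-syntax; ∃; ∃-syntax; _×_; _,_; proj₁; proj₂)
open import Data.Refinement using (Refinement; value)
open import Function.Definitions using (Injective)
open import Level using (0ℓ)
open import Relation.Binary using (Rel; Decidable; Symmetric)
open import Relation.Binary.PropositionalEquality using (_≡_; refl)
open import Relation.Nullary using (¬_; yes; no; contradiction; map′; _×-dec_)
open import Relation.Unary as U using (Pred)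

record Graph (V : Set) : Set₁ where
  field
    Adj    : Rel V 0ℓ
    adj?   : Decidable Adj
    sym    : Symmetric Adj
    irrefl : ∀ {x} → ¬ Adj x x

open Graph

-- Walks indexed by their number of edges.
data Walk {V : Set} (G : Graph V) : V → V → ℕ → Set where
  []  : ∀ {x} → Walk G x x 0
  _∷_ : ∀ {x y z m} → Adj G x y → Walk G y z m → Walk G x z (suc m)

Connected : {V : Set} → Graph V → Set
Connected G = ∀ x y → ∃[ m ] Walk G x y m

-- G ∖ S is the subgraph induced on the complement of S. Membership proofs in
-- the vertex type are irrelevant, so every remaining vertex occurs once.
_∖_ : {V : Set} → Graph V → (S : Pred V 0ℓ) → Graph (Refinement V (λ x → ¬ S x))
G ∖ S = record
  { Adj    = λ x y → Adj G (value x) (value y)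
  ; adj?   = λ x y → adj? G (value x) (value y)
  ; sym    = sym G
  ; irrefl = irrefl G
  }

degree : ∀ {n} → Graph (Fin n) → Fin n → ℕ
degree {n} G x = length (filter (adj? G x) (allFin n))

-- A walk of minimum length is necessarily a path, so this says that d is the
-- length of a shortest path from x to y.
IsDistance : {V : Set} → Graph V → V → V → ℕ → Set
IsDistance G x y d = Walk G x y d × (∀ {m} → Walk G x y m → d ≤ m)

walk? : ∀ {n} (G : Graph (Fin n)) x y → U.Decidable (Walk G x y)
walk? G x y zero    = map′ (λ { refl → [] }) (λ { [] → refl }) (x Fin.≟ y)
walk? G x y (suc m) = map′ (λ { (_ , e , p) → e ∷ p }) (λ { (e ∷ p) → _ , e , p })
                           (any? λ z → adj? G x z ×-dec walk? G z y m)

least : {P : Pred ℕ 0ℓ} → U.Decidable P → ∀ m → P m →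
        ∃[ d ] (P d × (∀ {j} → P j → d ≤ j))
least P? m p with P? 0
least P? m       p | yes p₀ = 0 , p₀ , λ _ → z≤n
least P? zero    p | no ¬p₀ = contradiction p ¬p₀
least P? (suc m) p | no ¬p₀ with least (λ j → P? (suc j)) m p
... | d , q , min = suc d , q , λ { {zero} r → contradiction r ¬p₀ ; {suc _} r → s≤s (min r) }

module _ {n} (G : Graph (Fin n)) (conn : Connected G) where

  distance : ∀ x y → ∃ (IsDistance G x y)
  distance x y = least (walk? G x y) (proj₁ (conn x y)) (proj₂ (conn x y))

  dist : Fin n → Fin n → ℕ
  dist x y = proj₁ (distance x y)

  Tr : Fin n → ℕ
  Tr x = ∑[ y < n ] dist x y

Internal : ∀ {k} → Fin (suc k) → Set
Internal {k} i = 0 < toℕ i × toℕ i < k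

record IsInternalPath {n} (G : Graph (Fin n)) (u v : Fin n)
                      {k} (w : Fin (suc k) → Fin n) : Set where
  field
    start    : w zero ≡ u
    end      : w (fromℕ k) ≡ v
    edge     : ∀ (i : Fin k) → Adj G (w (inject₁ i)) (w (suc i))
    distinct : Injective _≡_ _≡_ w
    degree≡2 : ∀ i → Internal i → degree G (w i) ≡ 2

InternalVertex : ∀ {n k} → (Fin (suc k) → Fin n) → Pred (Fin n) 0ℓ
InternalVertex w x = ∃[ i ] (Internal i × w i ≡ x)

-- For i : Fin k, the consecutive terms s (inject₁ i) and s (suc i) lie on the
-- initial segment ending at t iff suc i ≤ t, and on the final segment starting
-- at t iff t ≤ inject₁ i.
Unimodal : ∀ {k} → (Fin (suc k) → ℕ) → Set
Unimodal {k} s = Σ[ t ∈ Fin (suc k) ]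
  ( (∀ (i : Fin k) → suc i Fin.≤ t     → s (inject₁ i) ≤ s (suc i))
  × (∀ (i : Fin k) → t Fin.≤ inject₁ i → s (inject₁ i) ≥ s (suc i)))

InverselyUnimodal : ∀ {k} → (Fin (suc k) → ℕ) → Set
InverselyUnimodal {k} s = Σ[ t ∈ Fin (suc k) ]
  ( (∀ (i : Fin k) → suc i Fin.≤ t     → s (inject₁ i) ≥ s (suc i))
  × (∀ (i : Fin k) → t Fin.≤ inject₁ i → s (inject₁ i) ≤ s (suc i)))

{-# OPTIONS --safe #-}

-- Let c be an internal vertex of the path, with neighbours p and q, and let
-- a, b, d be the distances of a vertex y from p, q, c. For y ≠ c every walk
-- from c starts through p or q, so d = 1 + min(a, b) and 2d − a − b = 2 − |a − b| ≥ 0,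
-- while y = c contributes −2.
--
-- If some walk from p to q avoids c, then b − a changes sign along it, moving by
-- at most 2 per edge, so the walk contains a vertex with a = b or two vertices
-- with |a − b| = 1. Either way the −2 is compensated and Tr p + Tr q ≤ 2 Tr c.
-- If no such walk exists, then |a − b| = 2 for all y ≠ c and Tr p + Tr q ≥ 2 Tr c.
--
-- If H is connected, every c admits such a walk, so the transmission is concave
-- along the path; if a single c admits one, retracting the two parts of the path
-- around c to its ends shows that H is connected, so for disconnected H the
-- transmission is convex along the path.

module Submission where

open import Defs
open Graph
open import Data.Bool using (if_then_else_)
open import Data.Fin as Fin using (Fin; zero; suc; inject₁; fromℕ; toℕ)
open import Data.Fin.Properties as Fin using (any?; toℕ-inject₁; toℕ-fromℕ; toℕ-injective; toℕ<n)
open import Data.Irrelevant using ([_])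
open import Data.List using (List; []; _∷_; length)
open import Data.List.Membership.Propositional using (_∈_)
open import Data.List.Membership.Propositional.Properties using (∈-filter⁺; ∈-allFin)
open import Data.List.Relation.Unary.Any using (here; there)
open import Data.Nat using (ℕ; zero; suc; _+_; _≤_; _<_; z≤n; s≤s; z<s; s<s)
open import Data.Nat.Properties
open import Data.Product using (Σ-syntax; ∃-syntax; _×_; _,_; proj₁; proj₂)
open import Data.Refinement using (Refinement; value; _,_)
open import Data.Sum using (_⊎_; inj₁; inj₂)
open import Function using (_∘_; id)
open import Level using (0ℓ)
open import Relation.Binary using (Rel; Symmetric; tri<; tri≈; tri>)
open import Relation.Binary.Construct.Closure.ReflexiveTransitive using (Star; ε; _◅_; _◅◅_; return; reverse; gmap; kleisliStar)
open import Relation.Binary.PropositionalEquality as ≡ using (_≡_; _≢_; refl; trans; cong; cong₂; subst; subst₂)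
open import Relation.Nullary using (¬_; does; yes; no; contradiction; _×-dec_)
open import Relation.Nullary.Negation using (contradiction-irr)
open import Relation.Unary as U using (Pred)

open import Algebra.Properties.CommutativeMonoid.Sum +-0-commutativeMonoid using (sum; ∑-distrib-+; sum-replicate-zero)

-- Sums over Fin n

sum-mono-≤ : ∀ {n} {f g : Fin n → ℕ} → (∀ i → f i ≤ g i) → sum f ≤ sum g
sum-mono-≤ {zero}  f≤g = z≤n
sum-mono-≤ {suc n} f≤g = +-mono-≤ (f≤g zero) (sum-mono-≤ (f≤g ∘ suc))

𝟙 : ∀ {n} → Fin n → Fin n → ℕ
𝟙 z y = if does (y Fin.≟ z) then 1 else 0

𝟙-≢ : ∀ {n} {z y : Fin n} → y ≢ z → 𝟙 z y ≡ 0
𝟙-≢ {z = z} {y} y≢z with y Fin.≟ z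
... | yes y≡z = contradiction y≡z y≢z
... | no  _   = refl

sum-𝟙 : ∀ {n} (z : Fin n) → sum (𝟙 z) ≡ 1
sum-𝟙 {suc n} zero    = cong suc (sum-replicate-zero n)
sum-𝟙 {suc n} (suc z) = sum-𝟙 z

-- The two indicators carry a total correction of 2; `z` and `z′` may coincide, so that one vertex
-- can take both units.
sum-+-𝟙𝟙 : ∀ {n} (f g : Fin n → ℕ) (z z′ : Fin n) →
           sum (λ y → (f y + g y) + (𝟙 z y + 𝟙 z′ y)) ≡ (sum f + sum g) + 2
sum-+-𝟙𝟙 f g z z′ = trans (∑-distrib-+ (λ y → f y + g y) (λ y → 𝟙 z y + 𝟙 z′ y))
  (cong₂ _+_ (∑-distrib-+ f g) (trans (∑-distrib-+ (𝟙 z) (𝟙 z′)) (cong₂ _+_ (sum-𝟙 z) (sum-𝟙 z′))))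

-- Concave and convex sequences

-- `t` is the first index at which `P⊎Q` chooses `Q`, and `Q-step` propagates `Q` from there on. The
-- extra value of `Fin (suc (suc k))` is for the case that `Q` is never chosen.
crossover : ∀ {k} {P Q : Pred (Fin (suc k)) 0ℓ} → (∀ i → P i ⊎ Q i) →
            (∀ (i : Fin k) → Q (inject₁ i) → Q (suc i)) →
            Σ[ t ∈ Fin (suc (suc k)) ]
              ( (∀ i → suc i Fin.≤ t → P i)
              × (∀ i → t Fin.≤ inject₁ i → Q i))
crossover {k} {P} {Q} P⊎Q Q-step with P⊎Q zero
... | inj₂ q = zero , (λ _ ()) , λ i _ → Q-all Q-step q i
  where
  Q-all : ∀ {m} {R : Pred (Fin (suc m)) 0ℓ} → (∀ (i : Fin m) → R (inject₁ i) → R (suc i)) →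
          R zero → ∀ i → R i
  Q-all         step r zero    = r
  Q-all {suc m} step r (suc i) = Q-all (step ∘ suc) (step zero r) i
crossover {zero}  P⊎Q Q-step | inj₁ p = suc zero , (λ { zero _ → p }) , λ { zero () }
crossover {suc k} P⊎Q Q-step | inj₁ p with crossover (P⊎Q ∘ suc) (Q-step ∘ suc)
... | t , before , after = suc t
  , (λ { zero _ → p ; (suc i) (s≤s i<t) → before i i<t })
  , (λ { zero () ; (suc i) (s≤s t≤i) → after i t≤i })

concave⇒unimodal : ∀ {k} (s : Fin (suc (suc k)) → ℕ) →
  (∀ (i : Fin k) → s (inject₁ (inject₁ i)) + s (suc (suc i)) ≤ s (suc (inject₁ i)) + s (suc (inject₁ i))) →
  Unimodal s
concave⇒unimodal s concave = crossover (λ i → ≤-total (s (inject₁ i)) (s (suc i)))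
  -- A weak descent is followed by a weak descent: concavity bounds the sum of the second and third
  -- terms by twice the second.
  λ i x≥y → +-cancelˡ-≤ (s (suc (inject₁ i))) _ _
              (≤-trans (+-monoˡ-≤ (s (suc (suc i))) x≥y) (concave i))

convex⇒inverselyUnimodal : ∀ {k} (s : Fin (suc (suc k)) → ℕ) →
  (∀ (i : Fin k) → s (suc (inject₁ i)) + s (suc (inject₁ i)) ≤ s (inject₁ (inject₁ i)) + s (suc (suc i))) →
  InverselyUnimodal s
convex⇒inverselyUnimodal s convex = crossover (λ i → ≤-total (s (suc i)) (s (inject₁ i)))
  λ i x≤y → +-cancelˡ-≤ (s (suc (inject₁ i))) _ _
              (≤-trans (convex i) (+-monoˡ-≤ (s (suc (suc i))) x≤y))

-- Walks and distances

module _ {V : Set} {G : Graph V} where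

  snoc : ∀ {x y z m} → Walk G x y m → Adj G y z → Walk G x z (suc m)
  snoc []      f = f ∷ []
  snoc (e ∷ p) f = e ∷ snoc p f

  walk⇒star : ∀ {x y m} → Walk G x y m → Star (Adj G) x y
  walk⇒star []      = ε
  walk⇒star (e ∷ p) = e ◅ walk⇒star p

  star⇒walk : ∀ {x y} → Star (Adj G) x y → ∃[ m ] Walk G x y m
  star⇒walk ε = 0 , []
  star⇒walk (e ◅ p) with star⇒walk p
  ... | m , q = suc m , e ∷ q

module _ {V : Set} (G : Graph V) where

  -- Excluding both endpoints makes the relation symmetric, so that avoiding walks can be reversed.
  Avoiding : V → Rel V 0ℓ
  Avoiding c x y = Adj G x y × x ≢ c × y ≢ c

  avoiding-sym : ∀ {c} → Symmetric (Avoiding c)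
  avoiding-sym (e , x≢c , y≢c) = sym G e , y≢c , x≢c

module _ {n} (G : Graph (Fin n)) (conn : Connected G) where

  private
    d : Fin n → Fin n → ℕ
    d = dist G conn

  shortest : ∀ x y → Walk G x y (d x y)
  shortest x y = proj₁ (proj₂ (distance G conn x y))

  dist-min : ∀ {x y m} → Walk G x y m → d x y ≤ m
  dist-min {x} {y} = proj₂ (proj₂ (distance G conn x y))

  dist-refl : ∀ x → d x x ≡ 0
  dist-refl x = n≤0⇒n≡0 (dist-min {x} [])

  dist-adj : ∀ {x y} → Adj G x y → d x y ≤ 1
  dist-adj e = dist-min (e ∷ [])

  dist-pos : ∀ {x y} → x ≢ y → 0 < d x y
  dist-pos {x} {y} x≢y with d x y | shortest x y
  ... | zero  | [] = contradiction refl x≢y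
  ... | suc _ | _  = z<s

  dist-stepˡ : ∀ {x z} y → Adj G x z → d x y ≤ suc (d z y)
  dist-stepˡ {z = z} y e = dist-min (e ∷ shortest z y)

  dist-stepʳ : ∀ x {y z} → Adj G y z → d x z ≤ suc (d x y)
  dist-stepʳ x {y} e = dist-min (snoc (shortest x y) e)

  -- Cut the walk at its first visit to `c`: at least one edge precedes the visit, and the rest has
  -- length at least `d c y`.
  avoid⊎visit : ∀ {c x y m} → x ≢ c → Walk G x y m → Star (Avoiding G c) x y ⊎ suc (d c y) ≤ m
  avoid⊎visit x≢c [] = inj₁ ε
  avoid⊎visit {c} x≢c (_∷_ {y = z} e p) with z Fin.≟ c
  ... | yes refl = inj₂ (s≤s (dist-min p))
  ... | no  z≢c with avoid⊎visit z≢c p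
  ...   | inj₁ q   = inj₁ ((e , x≢c , z≢c) ◅ q)
  ...   | inj₂ c≤m = inj₂ (m≤n⇒m≤1+n c≤m)

  -- The inequality holds termwise. Shortest walks from `p` and `q` to `y` cannot both avoid `c`, as
  -- they would join up at `y`. The one through `c` gains 1 over `d c y`, and the other loses at
  -- most 1.
  convex-at : ∀ {p c q} → Adj G c p → Adj G c q → ¬ Star (Avoiding G c) p q →
              Tr G conn c + Tr G conn c ≤ Tr G conn p + Tr G conn q
  convex-at {p} {c} {q} cp cq separated =
    subst₂ _≤_ (∑-distrib-+ (d c) (d c)) (∑-distrib-+ (d p) (d q)) (sum-mono-≤ pointwise)
    where
    open ≤-Reasoning

    adj⇒≢ : ∀ {z} → Adj G c z → z ≢ c
    adj⇒≢ e refl = irrefl G e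

    pointwise : ∀ y → d c y + d c y ≤ d p y + d q y
    pointwise y with avoid⊎visit (adj⇒≢ cp) (shortest p y) | avoid⊎visit (adj⇒≢ cq) (shortest q y)
    ... | inj₁ py  | inj₁ qy = contradiction (py ◅◅ reverse (avoiding-sym G) qy) separated
    ... | inj₂ c<p | _       = begin
      d c y + d c y       ≤⟨ +-monoʳ-≤ (d c y) (dist-stepˡ y cq) ⟩
      d c y + suc (d q y) ≡⟨ +-suc (d c y) (d q y) ⟩
      suc (d c y) + d q y ≤⟨ +-monoˡ-≤ (d q y) c<p ⟩
      d p y + d q y       ∎
    ... | inj₁ _   | inj₂ c<q = begin
      d c y + d c y       ≤⟨ +-monoˡ-≤ (d c y) (dist-stepˡ y cp) ⟩
      suc (d p y) + d c y ≡⟨ +-suc (d p y) (d c y) ⟨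
      d p y + suc (d c y) ≤⟨ +-monoʳ-≤ (d p y) c<q ⟩
      d p y + d q y       ∎

  data Balance (p c q : Fin n) : Set where
    equidistant : ∀ {z} → z ≢ c → d p z ≡ d q z → Balance p c q
    swap        : ∀ {z z′} → z ≢ c → z′ ≢ c → z ≢ z′ →
                  d q z ≡ suc (d p z) → d p z′ ≡ suc (d q z′) → Balance p c q

  -- A discrete intermediate value argument: `d p x < d q x` cannot persist up to the end of the
  -- walk, where `d q q` is 0.
  balance : ∀ {p c q x} → d p x < d q x → Star (Avoiding G c) x q → Balance p c q
  balance {p} {q = q} p<q ε = contradiction (subst (d p q <_) (dist-refl q) p<q) λ ()
  balance {p} {c} {q} {x} p<q (_◅_ {j = x′} (e , x≢c , x′≢c) r) with <-cmp (d p x′) (d q x′)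
  ... | tri< p<q′ _ _ = balance p<q′ r
  ... | tri≈ _ p≡q′ _ = equidistant x′≢c p≡q′
  -- The chain d p x + 1 ≤ d q x ≤ d q x′ + 1 ≤ d p x′ ≤ d p x + 1 forces equality throughout.
  ... | tri> _ _ q<p′ = swap x≢c x′≢c (λ { refl → irrefl G e })
                          (≤-antisym (≤-trans q≤q′ (≤-trans q<p′ p′≤p)) p<q)
                          (≤-antisym (≤-trans p′≤p (≤-trans p<q q≤q′)) q<p′)
    where
    q≤q′ : d q x ≤ suc (d q x′)
    q≤q′ = dist-stepʳ q (sym G e)
    p′≤p : d p x′ ≤ suc (d p x)
    p′≤p = dist-stepʳ p e

  -- Termwise deficits at a vertex with two neighbours

  module _ {p c q} (cp : Adj G c p) (cq : Adj G c q)
           (neighbours : ∀ {z} → Adj G c z → z ≡ p ⊎ z ≡ q) where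

    first-step : ∀ {y} → y ≢ c → d p y < d c y ⊎ d q y < d c y
    first-step {y} y≢c with d c y | shortest c y
    ... | _ | []    = contradiction refl y≢c
    ... | _ | e ∷ r with neighbours e
    ...   | inj₁ refl = inj₁ (s≤s (dist-min r))
    ...   | inj₂ refl = inj₂ (s≤s (dist-min r))

    nearerˡ : ∀ {y} → y ≢ c → d p y ≤ d q y → d p y < d c y
    nearerˡ y≢c p≤q with first-step y≢c
    ... | inj₁ p<c = p<c
    ... | inj₂ q<c = ≤-<-trans p≤q q<c

    nearerʳ : ∀ {y} → y ≢ c → d q y ≤ d p y → d q y < d c y
    nearerʳ y≢c q≤p with first-step y≢c
    ... | inj₁ p<c = ≤-<-trans q≤p p<c
    ... | inj₂ q<c = q<c

    -- One neighbour of `c` is nearer to `y` by at least 1 and the other is farther by at most 1.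
    -- The summands 0, 1, 2 in this and the next lemmas are what `𝟙 z y + 𝟙 z′ y` reduces to once
    -- the equality tests are decided.
    deficit≥0 : ∀ {y} → y ≢ c → (d p y + d q y) + 0 ≤ d c y + d c y
    deficit≥0 {y} y≢c rewrite +-identityʳ (d p y + d q y) with first-step y≢c
    ... | inj₁ p<c = ≤-pred (≤-trans (+-mono-≤ p<c (dist-stepˡ y (sym G cq))) (≤-reflexive (+-suc (d c y) (d c y))))
    ... | inj₂ q<c = ≤-pred (≤-trans (≤-reflexive (≡.sym (+-suc (d p y) (d q y)))) (+-mono-≤ (dist-stepˡ y (sym G cp)) q<c))

    -- Here `p` is strictly nearer to `y` than `c`, and `q`, being only one step farther than `p`,
    -- is no farther than `c`.
    deficit≥1ˡ : ∀ {y} → y ≢ c → d q y ≡ suc (d p y) → (d p y + d q y) + 1 ≤ d c y + d c y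
    deficit≥1ˡ {y} y≢c q≡1+p = ≤-trans (≤-reflexive (+-comm (d p y + d q y) 1))
      (+-mono-≤ p<c (≤-trans (≤-reflexive q≡1+p) p<c))
      where
      p<c : d p y < d c y
      p<c = nearerˡ y≢c (≤-trans (n≤1+n _) (≤-reflexive (≡.sym q≡1+p)))

    deficit≥1ʳ : ∀ {y} → y ≢ c → d p y ≡ suc (d q y) → (d p y + d q y) + 1 ≤ d c y + d c y
    deficit≥1ʳ {y} y≢c p≡1+q = ≤-trans (≤-reflexive (trans (+-assoc (d p y) (d q y) 1) (cong (d p y +_) (+-comm (d q y) 1))))
      (+-mono-≤ (≤-trans (≤-reflexive p≡1+q) q<c) q<c)
      where
      q<c : d q y < d c y
      q<c = nearerʳ y≢c (≤-trans (n≤1+n _) (≤-reflexive (≡.sym p≡1+q)))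

    -- At equal distances both neighbours are strictly nearer to `y` than `c`.
    deficit≥2 : ∀ {y} → y ≢ c → d p y ≡ d q y → (d p y + d q y) + 2 ≤ d c y + d c y
    deficit≥2 {y} y≢c p≡q = ≤-trans (≤-reflexive (trans (+-comm (d p y + d q y) 2) (cong suc (≡.sym (+-suc (d p y) (d q y))))))
      (+-mono-≤ (nearerˡ y≢c (≤-reflexive p≡q)) (nearerʳ y≢c (≤-reflexive (≡.sym p≡q))))

    Compensated : Fin n → Fin n → Set
    Compensated z z′ = ∀ {y} → y ≢ c → (d p y + d q y) + (𝟙 z y + 𝟙 z′ y) ≤ d c y + d c y

    compensate : Balance p c q → ∃[ z ] ∃[ z′ ] (z ≢ c × z′ ≢ c × Compensated z z′)
    compensate (equidistant {z} z≢c p≡q) = z , z , z≢c , z≢c , pointwise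
      where
      pointwise : Compensated z z
      pointwise {y} y≢c with y Fin.≟ z
      ... | yes refl = deficit≥2 y≢c p≡q
      ... | no  _    = deficit≥0 y≢c
    compensate (swap {z} {z′} z≢c z′≢c z≢z′ q≡1+p p≡1+q) = z , z′ , z≢c , z′≢c , pointwise
      where
      pointwise : Compensated z z′
      pointwise {y} y≢c with y Fin.≟ z | y Fin.≟ z′
      ... | yes refl | yes refl = contradiction refl z≢z′
      ... | yes refl | no  _    = deficit≥1ˡ y≢c q≡1+p
      ... | no  _    | yes refl = deficit≥1ʳ y≢c p≡1+q
      ... | no  _    | no  _    = deficit≥0 y≢c

    -- With `𝟙 z + 𝟙 z′` added on the left and twice `𝟙 c` on the right, the inequality holds at
    -- every `y`. Both corrections sum to 2 and cancel.
    concave-at : p ≢ q → Star (Avoiding G c) p q →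
                 Tr G conn p + Tr G conn q ≤ Tr G conn c + Tr G conn c
    -- The walk starts at `p`, where `d p p` is 0 and `d q p` is positive.
    concave-at p≢q r with compensate (balance (subst (_< d q p) (≡.sym (dist-refl p)) (dist-pos (p≢q ∘ ≡.sym))) r)
    ... | z , z′ , z≢c , z′≢c , compensated = +-cancelʳ-≤ 2 _ _
      (subst₂ _≤_ (sum-+-𝟙𝟙 (d p) (d q) z z′) (sum-+-𝟙𝟙 (d c) (d c) c c) (sum-mono-≤ pointwise))
      where
      pointwise : ∀ y → (d p y + d q y) + (𝟙 z y + 𝟙 z′ y) ≤ (d c y + d c y) + (𝟙 c y + 𝟙 c y)
      pointwise y with y Fin.≟ c
      ... | no  y≢c  = ≤-trans (compensated y≢c) (m≤m+n _ 0)
      -- At `y = c` the left indicators vanish and `d c c` is 0, so what remains is that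
      -- `d p c + d q c` is at most 2.
      ... | yes refl rewrite 𝟙-≢ (z≢c ∘ ≡.sym) | 𝟙-≢ (z′≢c ∘ ≡.sym) | dist-refl y | +-identityʳ (d p y + d q y) =
        +-mono-≤ (dist-adj (sym G cp)) (dist-adj (sym G cq))

-- Paths

module _ {A : Set} {R : Rel A 0ℓ} where

  path-prefix : ∀ {k} (g : Fin (suc k) → A) j →
                (∀ e → suc e Fin.≤ j → R (g (inject₁ e)) (g (suc e))) → Star R (g zero) (g j)
  path-prefix         g zero    steps = ε
  path-prefix {suc k} g (suc j) steps = steps zero (s≤s z≤n) ◅ path-prefix (g ∘ suc) j (λ e e<j → steps (suc e) (s≤s e<j))

  path-suffix : ∀ {k} (g : Fin (suc k) → A) j →
                (∀ e → j Fin.≤ inject₁ e → R (g (inject₁ e)) (g (suc e))) → Star R (g j) (g (fromℕ k))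
  path-suffix {zero}  g zero    steps = ε
  path-suffix {suc k} g zero    steps = steps zero z≤n ◅ path-suffix (g ∘ suc) zero (λ e _ → steps (suc e) z≤n)
  path-suffix {suc k} g (suc j) steps = path-suffix (g ∘ suc) j (λ e j≤e → steps (suc e) (s≤s j≤e))

two-elements : ∀ {A : Set} {p q r : A} {xs : List A} → length xs ≡ 2 →
               p ∈ xs → q ∈ xs → p ≢ q → r ∈ xs → r ≡ p ⊎ r ≡ q
two-elements {xs = _ ∷ _ ∷ []} _ (here refl)         (here refl)         p≢q _                   = contradiction refl p≢q
two-elements {xs = _ ∷ _ ∷ []} _ (there (here refl)) (there (here refl)) p≢q _                   = contradiction refl p≢q
two-elements {xs = _ ∷ _ ∷ []} _ (here refl)         (there (here refl)) _   (here refl)         = inj₁ refl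
two-elements {xs = _ ∷ _ ∷ []} _ (here refl)         (there (here refl)) _   (there (here refl)) = inj₂ refl
two-elements {xs = _ ∷ _ ∷ []} _ (there (here refl)) (here refl)         _   (here refl)         = inj₂ refl
two-elements {xs = _ ∷ _ ∷ []} _ (there (here refl)) (here refl)         _   (there (here refl)) = inj₁ refl

degree-two : ∀ {n} (G : Graph (Fin n)) {p c q z} → degree G c ≡ 2 →
             Adj G c p → Adj G c q → p ≢ q → Adj G c z → z ≡ p ⊎ z ≡ q
degree-two {n} G {c = c} deg cp cq p≢q cz = two-elements deg (member cp) (member cq) p≢q (member cz)
  where
  member : ∀ {y} → Adj G c y → y ∈ _
  member {y} cy = ∈-filter⁺ (adj? G c) (∈-allFin y) cy

-- Internal positions are reindexed as centres of three consecutive positions, which gives both path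
-- neighbours without subtraction.
internal-index : ∀ {k} (j : Fin (suc (suc k))) → Internal j → ∃[ i ] j ≡ suc (inject₁ {k} i)
internal-index {zero}  (suc zero)    (_ , s≤s ())
internal-index {suc k} (suc zero)    _ = zero , refl
internal-index {suc k} (suc (suc j)) (_ , s≤s j<k) with internal-index (suc j) (z<s , j<k)
... | i , refl = suc i , refl

internal-centre : ∀ {k} (i : Fin k) → Internal (suc (inject₁ i))
internal-centre i = z<s , s<s (subst (_< _) (≡.sym (toℕ-inject₁ i)) (toℕ<n i))

endpoint : ∀ {k} (j : Fin (suc k)) → ¬ Internal j → j ≡ zero ⊎ j ≡ fromℕ k
endpoint         zero    _    = inj₁ refl
endpoint {suc k} (suc j) ¬int = inj₂ (toℕ-injective (trans
  (≤-antisym (≤-pred (toℕ<n (suc j))) (≮⇒≥ λ j<k → ¬int (z<s , j<k))) (≡.sym (toℕ-fromℕ (suc k)))))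

module _ {n} (G : Graph (Fin n)) {u v k} {w : Fin (suc (suc k)) → Fin n}
         (path : IsInternalPath G u v w) where

  open IsInternalPath path using (edge; distinct; degree≡2)

  private
    H : Graph (Refinement (Fin n) (λ x → ¬ InternalVertex w x))
    H = G ∖ InternalVertex w

    left centre right : Fin k → Fin (suc (suc k))
    left   i = inject₁ (inject₁ i)
    centre i = suc (inject₁ i)
    right  i = suc (suc i)

    H-reverse : Symmetric (Star (Adj H))
    H-reverse = reverse λ {x} {y} → sym H {x} {y}

  edgeˡ : ∀ i → Adj G (w (centre i)) (w (left i))
  edgeˡ i = sym G (edge (inject₁ i))

  edgeʳ : ∀ i → Adj G (w (centre i)) (w (right i))
  edgeʳ i = edge (suc i)

  toℕ-left : ∀ i → toℕ (left i) ≡ toℕ i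
  toℕ-left i = trans (toℕ-inject₁ (inject₁ i)) (toℕ-inject₁ i)

  toℕ-centre : ∀ i → toℕ (centre i) ≡ suc (toℕ i)
  toℕ-centre i = cong suc (toℕ-inject₁ i)

  w-≢ : ∀ {i j} → toℕ i ≢ toℕ j → w i ≢ w j
  w-≢ i≢j eq = i≢j (cong toℕ (distinct eq))

  left≢right : ∀ i → w (left i) ≢ w (right i)
  left≢right i = w-≢ λ eq → <⇒≢ (m≤n⇒m≤1+n ≤-refl) (trans (≡.sym (toℕ-left i)) eq)

  neighbours : ∀ i {z} → Adj G (w (centre i)) z → z ≡ w (left i) ⊎ z ≡ w (right i)
  neighbours i = degree-two G (degree≡2 (centre i) (internal-centre i)) (edgeˡ i) (edgeʳ i) (left≢right i)

  ends-survive : ∀ {j} → ¬ Internal j → ¬ InternalVertex w (w j)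
  ends-survive ¬int (i , int , eq) = ¬int (subst Internal (distinct eq) int)

  first last : Refinement (Fin n) (λ x → ¬ InternalVertex w x)
  first = w zero , [ ends-survive (λ { (() , _) }) ]
  last  = w (fromℕ (suc k)) , [ ends-survive (λ { (_ , k<k) → <-irrefl (toℕ-fromℕ (suc k)) k<k }) ]

  avoiding-edge : ∀ i e → toℕ e ≢ toℕ i → toℕ e ≢ suc (toℕ i) →
                  Avoiding G (w (centre i)) (w (inject₁ e)) (w (suc e))
  avoiding-edge i e e≢i e≢1+i = edge e
    , w-≢ (λ eq → e≢1+i (trans (≡.sym (toℕ-inject₁ e)) (trans eq (toℕ-centre i))))
    , w-≢ (λ eq → e≢i (suc-injective (trans eq (toℕ-centre i))))

  -- The detour runs back along the path from the left neighbour to `w zero`, through `H` to the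
  -- other end, and back along the path to the right neighbour. Its middle part avoids the centre
  -- because `H` has lost that vertex.
  connected⇒avoiding : Connected H → ∀ i → Star (Avoiding G (w (centre i))) (w (left i)) (w (right i))
  connected⇒avoiding connH i =
       reverse (avoiding-sym G) (path-prefix w (left i) before)
    ◅◅ gmap value (λ {x} {y} → lift {x} {y}) (walk⇒star (proj₂ (connH first last)))
    ◅◅ reverse (avoiding-sym G) (path-suffix w (right i) after)
    where
    before : ∀ e → suc e Fin.≤ left i → Avoiding G (w (centre i)) (w (inject₁ e)) (w (suc e))
    before e 1+e≤i = avoiding-edge i e (<⇒≢ e<i) (<⇒≢ (m≤n⇒m≤1+n e<i))
      where
      e<i : toℕ e < toℕ i
      e<i = ≤-trans 1+e≤i (≤-reflexive (toℕ-left i))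

    after : ∀ e → right i Fin.≤ inject₁ e → Avoiding G (w (centre i)) (w (inject₁ e)) (w (suc e))
    after e 2+i≤e = avoiding-edge i e (>⇒≢ (<-trans (n<1+n _) 1+i<e)) (>⇒≢ 1+i<e)
      where
      1+i<e : suc (toℕ i) < toℕ e
      1+i<e = ≤-trans 2+i≤e (≤-reflexive (toℕ-inject₁ e))

    survivor≢ : ∀ x → value x ≢ w (centre i)
    survivor≢ (x , [ ¬int ]) eq = contradiction-irr ¬int (λ ¬int′ → ¬int′ (centre i , internal-centre i , ≡.sym eq))

    lift : ∀ {x y} → Adj H x y → Avoiding G (w (centre i)) (value x) (value y)
    lift {x} {y} e = e , survivor≢ x , survivor≢ y

  -- Retraction of the path onto its ends

  internal? : U.Decidable (InternalVertex w)
  internal? x = any? λ j → (0 <? toℕ j ×-dec toℕ j <? suc k) ×-dec (w j Fin.≟ x)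

  internal-neighbour : ∀ {j z} → Internal j → Adj G (w j) z →
                       ∃[ e ] (inject₁ e ≡ j × w (suc e) ≡ z ⊎ suc e ≡ j × w (inject₁ e) ≡ z)
  internal-neighbour {j} int jz with internal-index j int
  ... | i , refl with neighbours i jz
  ...   | inj₁ refl = inject₁ i , inj₂ (refl , refl)
  ...   | inj₂ refl = suc i , inj₁ (refl , refl)

  module _ (i : Fin k) where

    -- The cut lies between `left i`, at position `i`, and `centre i`, which falls on the `last`
    -- side. The only path edge crossing it is the one joining these two.
    end : Fin (suc (suc k)) → Refinement (Fin n) (λ x → ¬ InternalVertex w x)
    end j with toℕ j ≤? toℕ i
    ... | yes _ = first
    ... | no  _ = last

    end-first : ∀ {j} → toℕ j ≤ toℕ i → end j ≡ first
    end-first {j} j≤i with toℕ j ≤? toℕ i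
    ... | yes _   = refl
    ... | no  j≰i = contradiction j≤i j≰i

    end-last : ∀ {j} → toℕ i < toℕ j → end j ≡ last
    end-last {j} i<j with toℕ j ≤? toℕ i
    ... | yes j≤i = contradiction j≤i (<⇒≱ i<j)
    ... | no  _   = refl

    retract : Fin n → Refinement (Fin n) (λ x → ¬ InternalVertex w x)
    retract x with internal? x
    ... | yes (j , _) = end j
    ... | no  ¬int    = x , [ ¬int ]

    retract-survivor : ∀ x → retract (value x) ≡ x
    retract-survivor (x , [ ¬int ]) with internal? x
    ... | yes int = contradiction-irr ¬int (λ ¬int′ → ¬int′ int)
    ... | no  _   = refl

    retract-path : ∀ j → retract (w j) ≡ end j
    retract-path j with internal? (w j)
    ... | yes (j′ , _ , eq) = cong end (distinct eq)
    ... | no  ¬int with endpoint j (λ int → ¬int (j , int , refl))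
    -- `end zero` computes to `first`, and the two vertices differ only in irrelevant proofs.
    ...   | inj₁ refl = refl
    ...   | inj₂ refl = ≡.sym (end-last (≤-trans (m≤n⇒m≤1+n (toℕ<n i)) (≤-reflexive (≡.sym (toℕ-fromℕ (suc k))))))

    -- `R` is used twice: as `Avoiding G (w (centre i))` to join `first` to `last` in `H`, and then
    -- as `Adj G` to connect all of `H`. The hypothesis `joined` concerns path edges alone, because
    -- every edge at an internal vertex is a path edge.
    module _ {R : Rel (Fin n) 0ℓ} (R⇒Adj : ∀ {x y} → R x y → Adj G x y) (R-sym : Symmetric R)
             (joined : ∀ e → R (w (inject₁ e)) (w (suc e)) → Star (Adj H) (end (inject₁ e)) (end (suc e))) where

      retract-from-internal : ∀ {j z} → Internal j → R (w j) z → Star (Adj H) (end j) (retract z)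
      retract-from-internal int r with internal-neighbour int (R⇒Adj r)
      ... | e , inj₁ (refl , refl) = subst (Star (Adj H) _) (≡.sym (retract-path (suc e))) (joined e r)
      ... | e , inj₂ (refl , refl) = subst (Star (Adj H) _) (≡.sym (retract-path (inject₁ e)))
                                       (H-reverse (joined e (R-sym r)))

      retract-edge : ∀ {x y} → R x y → Star (Adj H) (retract x) (retract y)
      retract-edge {x} {y} r with internal? x
      ... | yes (j , int , refl) = retract-from-internal int r
      ... | no  ¬int with internal? y
      ...   | no  _                = return (R⇒Adj r)
      ...   | yes (j , int , refl) = H-reverse (subst (Star (Adj H) (end j))
                (retract-survivor (x , [ ¬int ])) (retract-from-internal int (R-sym r)))

      retract-star : ∀ {x y} → Star R x y → Star (Adj H) (retract x) (retract y)
      retract-star = kleisliStar retract retract-edge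

    -- The crossing edge is the one with `e` equal to `i`, and it ends at the avoided centre. Any
    -- other path edge has both endpoints on one side of the cut, so its image is a single vertex.
    avoiding⇒joined : ∀ e → Avoiding G (w (centre i)) (w (inject₁ e)) (w (suc e)) →
                      Star (Adj H) (end (inject₁ e)) (end (suc e))
    avoiding⇒joined e (_ , _ , e≢i) with <-cmp (toℕ e) (toℕ i)
    ... | tri< e<i _ _ = subst₂ (Star (Adj H))
                           (≡.sym (end-first (≤-trans (≤-reflexive (toℕ-inject₁ e)) (<⇒≤ e<i))))
                           (≡.sym (end-first e<i)) ε
    ... | tri≈ _ e≡i _ = contradiction (cong w (toℕ-injective (trans (cong suc e≡i) (≡.sym (toℕ-centre i))))) e≢i
    ... | tri> _ _ i<e = subst₂ (Star (Adj H))
                           (≡.sym (end-last (≤-trans i<e (≤-reflexive (≡.sym (toℕ-inject₁ e))))))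
                           (≡.sym (end-last (m≤n⇒m≤1+n i<e))) ε

    avoiding⇒first~last : Star (Avoiding G (w (centre i))) (w (left i)) (w (right i)) → Star (Adj H) first last
    avoiding⇒first~last r = subst₂ (Star (Adj H))
      (trans (retract-path (left i)) (end-first (≤-reflexive (toℕ-left i))))
      (trans (retract-path (right i)) (end-last (m≤n⇒m≤1+n ≤-refl)))
      (retract-star proj₁ (avoiding-sym G) avoiding⇒joined r)

    first~last⇒ends-joined : Star (Adj H) first last → ∀ j j′ → Star (Adj H) (end j) (end j′)
    first~last⇒ends-joined r j j′ with toℕ j ≤? toℕ i | toℕ j′ ≤? toℕ i
    ... | yes _ | yes _ = ε
    ... | yes _ | no  _ = r
    ... | no  _ | yes _ = H-reverse r
    ... | no  _ | no  _ = ε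

    -- Once `first` and `last` are joined in `H`, the retraction carries every walk of `G` to a walk
    -- of `H`, and it fixes the surviving endpoints.
    avoiding⇒connected : Connected G → Star (Avoiding G (w (centre i))) (w (left i)) (w (right i)) → Connected H
    avoiding⇒connected conn r x y = star⇒walk (subst₂ (Star (Adj H)) (retract-survivor x) (retract-survivor y)
      (retract-star id (sym G) (λ e _ → first~last⇒ends-joined (avoiding⇒first~last r) (inject₁ e) (suc e))
        (walk⇒star (proj₂ (conn (value x) (value y))))))

theorem1 : (n : ℕ) (G : Graph (Fin n)) (conn : Connected G) (u v : Fin n)
    (k : ℕ) → 2 ≤ k →
    (w : Fin (suc k) → Fin n) → IsInternalPath G u v w →
    let H = G ∖ InternalVertex w in
    (Connected H → Unimodal (λ i → Tr G conn (w i)))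
    × (¬ Connected H → InverselyUnimodal (λ i → Tr G conn (w i)))
theorem1 n G conn u v (suc k) _ w path =
    (λ connH → concave⇒unimodal (λ j → Tr G conn (w j)) λ i →
      concave-at G conn (edgeˡ G path i) (edgeʳ G path i) (neighbours G path i)
        (left≢right G path i) (connected⇒avoiding G path connH i))
  , (λ ¬connH → convex⇒inverselyUnimodal (λ j → Tr G conn (w j)) λ i →
      convex-at G conn (edgeˡ G path i) (edgeʳ G path i)
        (λ r → ¬connH (avoiding⇒connected G path i conn r)))
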